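{- Every finite locally unital MTL-chain is (isomorphic to) an ordinal sum of archimedean MTL-chains.
   Context: A semihoop is an algebra $(A,\cdot,\rightarrow,\wedge,\vee,1)$ such that $(A,\wedge,\vee)$ is a lattice with greatest element $1$, $(A,\cdot,1)$ is a commutative monoid, and for all $x,y,z\in A$: $xy\le z$ if and only if $x\le y\rightarrow z$, and $(x\rightarrow y)\vee(y\rightarrow x)=1$. An MTL-algebra is a semihoop with a least element $0$; an MTL-chain is a totally ordered MTL-algebra. An MTL-algebra is locally unital if it satisfies the quasi-identity: if $e^2=e$ and $e\vee x=e$, then $ex=x$. An MTL-chain is archimedean if for all $x\le y<1$ there is $n\in\mathbb{N}$ with $y^n\le x$. Ordinal sum: let $(I,\le)$ be a totally ordered set and $\{A_i\}_{i\in I}$ a family of totally ordered semihoops, whose units are identified and which are otherwise made disjoint, so $A_i\cap A_j=\{1\}$ for $i\ne j$. The ordinal sum $\bigoplus_{i\in I}A_i$ has universe $\bigcup_{i\in I}A_i$ and operations: $x\cdot y=x\cdot_i y$ if $x,y\in A_i$; $x\cdot y=y$ if $x\in A_i$, $y\in A_j-\{1\}$, $i>j$; $x\cdot y=x$ if $x\in A_i-\{1\}$, $y\in A_j$, $i<j$; and $x\rightarrow y=x\rightarrow_i y$ if $x,y\in A_i$; $x\rightarrow y=y$ if $x\in A_i$, $y\in A_j$, $i>j$; $x\rightarrow y=1$ if $x\in A_i-\{1\}$, $y\in A_j$, $i<j$. Its order is total, given by $x\le y$ iff $x\rightarrow y=1$ (it extends the order of each $A_i$, and elements of $A_i-\{1\}$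 lie below those of $A_j$ when $i<j$). -}

module Defs where

open import Level using (Level; _⊔_; suc)
open import Algebra.Bundles using (RawMonoid)
open import Algebra.Core using (Op₂)
open import Algebra.Definitions using (Congruent₂)
open import Algebra.Definitions.RawMonoid using (_×_)
open import Algebra.Lattice.Structures using (IsLattice)
open import Algebra.Morphism.Definitions using (Homomorphic₀; Homomorphic₂)
open import Algebra.Structures using (IsCommutativeMonoid)
open import Data.Bool.Base using (if_then_else_)
open import Data.Fin.Base using (Fin)
open import Data.Nat.Base using (ℕ)
open import Data.Product.Base using (Σ; ∃; _,_; proj₂)
open import Function.Bundles using (Inverse; _⇔_)
open import Function.Definitions using (Congruent; Bijective)
open import Relation.Binary.Bundles using (Setoid)
open import Relation.Binary.Construct.NaturalOrder.Left as NaturalOrder using ()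
open import Relation.Binary.Construct.NonStrictToStrict as ToStrict using ()
open import Relation.Binary.Core using (Rel)
open import Relation.Binary.Definitions using (Decidable; Maximum; Minimum; Total; tri<; tri≈; tri>)
open import Relation.Binary.PropositionalEquality using (_≡_; refl; setoid)
open import Relation.Binary.Structures using (IsDecTotalOrder; IsStrictTotalOrder)
open import Relation.Nullary.Decidable using (Dec; does)

record RawSemihoop (c ℓ : Level) : Set (suc (c ⊔ ℓ)) where
  infixl 7 _·_
  infixr 6 _∧_ _∨_
  infixr 5 _⇒_
  infix  4 _≈_ _<_
  infixr 8 _^_
  field
    Carrier : Set c
    _≈_     : Rel Carrier ℓ
    _·_     : Op₂ Carrier
    _⇒_     : Op₂ Carrier
    _∧_     : Op₂ Carrier
    _∨_     : Op₂ Carrier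
    1#      : Carrier

  -- x ≤ y is x ≈ x ∧ y
  open NaturalOrder _≈_ _∧_ public using (_≤_)

  _<_ : Rel Carrier ℓ
  _<_ = ToStrict._<_ _≈_ _≤_

  ·-rawMonoid : RawMonoid c ℓ
  ·-rawMonoid = record { Carrier = Carrier ; _≈_ = _≈_ ; _∙_ = _·_ ; ε = 1# }

  _^_ : Carrier → ℕ → Carrier
  x ^ n = _×_ ·-rawMonoid n x

record IsSemihoop {c ℓ} (S : RawSemihoop c ℓ) : Set (c ⊔ ℓ) where
  open RawSemihoop S
  field
    isLattice             : IsLattice _≈_ _∨_ _∧_
    1-greatest            : Maximum _≤_ 1#
    ·-isCommutativeMonoid : IsCommutativeMonoid _≈_ _·_ 1#
    ⇒-cong                : Congruent₂ _≈_ _⇒_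
    residuation           : ∀ x y z → (x · y ≤ z) ⇔ (x ≤ y ⇒ z)
    prelinearity          : ∀ x y → (x ⇒ y) ∨ (y ⇒ x) ≈ 1#

record Semihoop (c ℓ : Level) : Set (suc (c ⊔ ℓ)) where
  field
    rawSemihoop : RawSemihoop c ℓ
    isSemihoop  : IsSemihoop rawSemihoop
  open RawSemihoop rawSemihoop public
  open IsSemihoop isSemihoop public

  ≈-setoid : Setoid c ℓ
  ≈-setoid = record { isEquivalence = IsLattice.isEquivalence isLattice }

record SemihoopChain (c ℓ : Level) : Set (suc (c ⊔ ℓ)) where
  field
    semihoop : Semihoop c ℓ
  open Semihoop semihoop public
  field
    ≤-total : Total _≤_

record MTLAlgebra (c ℓ : Level) : Set (suc (c ⊔ ℓ)) where
  field
    semihoop : Semihoop c ℓ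
  open Semihoop semihoop public
  field
    0#      : Carrier
    0-least : Minimum _≤_ 0#

record MTLChain (c ℓ : Level) : Set (suc (c ⊔ ℓ)) where
  field
    mtlAlgebra : MTLAlgebra c ℓ
  open MTLAlgebra mtlAlgebra public
  field
    ≤-total : Total _≤_

  semihoopChain : SemihoopChain c ℓ
  semihoopChain = record { semihoop = semihoop ; ≤-total = ≤-total }

LocallyUnital : ∀ {c ℓ} → MTLAlgebra c ℓ → Set (c ⊔ ℓ)
LocallyUnital A = ∀ e x → e · e ≈ e → e ∨ x ≈ e → e · x ≈ x
  where open MTLAlgebra A

Archimedean : ∀ {c ℓ} → MTLChain c ℓ → Set (c ⊔ ℓ)
Archimedean A = ∀ x y → x ≤ y → y < 1# → ∃ λ n → y ^ n ≤ x
  where open MTLChain A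

Finite : ∀ {c ℓ} → Setoid c ℓ → Set (c ⊔ ℓ)
Finite S = ∃ λ n → Inverse (setoid (Fin n)) S

record IsSemihoopIsomorphism {a ℓ₁ b ℓ₂} (A : RawSemihoop a ℓ₁) (B : RawSemihoop b ℓ₂)
         (f : RawSemihoop.Carrier A → RawSemihoop.Carrier B) : Set (a ⊔ ℓ₁ ⊔ b ⊔ ℓ₂) where
  private
    module A = RawSemihoop A
    module B = RawSemihoop B
  field
    cong      : Congruent A._≈_ B._≈_ f
    ·-homo    : Homomorphic₂ A.Carrier B.Carrier B._≈_ f A._·_ B._·_
    ⇒-homo    : Homomorphic₂ A.Carrier B.Carrier B._≈_ f A._⇒_ B._⇒_
    ∧-homo    : Homomorphic₂ A.Carrier B.Carrier B._≈_ f A._∧_ B._∧_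
    ∨-homo    : Homomorphic₂ A.Carrier B.Carrier B._≈_ f A._∨_ B._∨_
    1-homo    : Homomorphic₀ A.Carrier B.Carrier B._≈_ f A.1# B.1#
    bijective : Bijective A._≈_ B._≈_ f

infix 4 _≅_

-- An isomorphism of semihoops is an order isomorphism, so it also preserves 0
-- when there is one.
_≅_ : ∀ {a ℓ₁ b ℓ₂} → RawSemihoop a ℓ₁ → RawSemihoop b ℓ₂ → Set (a ⊔ ℓ₁ ⊔ b ⊔ ℓ₂)
A ≅ B = Σ (RawSemihoop.Carrier A → RawSemihoop.Carrier B) (IsSemihoopIsomorphism A B)

-- The operations are defined by cases, so the order on I and the equality of
-- each summand are required to be decidable. I is nonempty: the index i₀ serves
-- only to name the unit 1 = (i₀ , 1), which is identified with every (i , 1).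
module OrdinalSum {ι ℓι c ℓ} {I : Set ι} {_≤ᴵ_ : Rel I ℓι}
  (≤ᴵ-isDecTotalOrder : IsDecTotalOrder _≡_ _≤ᴵ_) (i₀ : I)
  (A : I → SemihoopChain c ℓ)
  (_≟_ : ∀ {i} → Decidable (SemihoopChain._≈_ (A i))) where

  private
    module A {i} = SemihoopChain (A i)
    open A using (_·_; _⇒_; 1#) renaming (_≈_ to _≈ᴬ_)

  open IsStrictTotalOrder (ToStrict.<-isStrictTotalOrder₂ _≡_ _≤ᴵ_ ≤ᴵ-isDecTotalOrder)
    using (compare)

  infix  4 _≈⊕_
  infixl 7 _·⊕_
  infixr 6 _∧⊕_ _∨⊕_
  infixr 5 _⇒⊕_

  Union : Set (ι ⊔ c)
  Union = Σ I λ i → A.Carrier {i}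

  data _≈⊕_ : Rel Union (ι ⊔ c ⊔ ℓ) where
    unit : ∀ {i j} {x : A.Carrier {i}} {y : A.Carrier {j}} →
           x ≈ᴬ 1# → y ≈ᴬ 1# → (i , x) ≈⊕ (j , y)
    same : ∀ {i} {x y : A.Carrier {i}} → x ≈ᴬ y → (i , x) ≈⊕ (i , y)

  1⊕ : Union
  1⊕ = i₀ , 1#

  -- For i < j and x = 1 (likewise i > j and y = 1), the unit also lies in the
  -- other summand, and the value is the one computed there.
  _·⊕_ : Op₂ Union
  (i , x) ·⊕ (j , y) with compare i j
  ... | tri< _ _ _    = if does (x ≟ 1#) then (j , y) else (i , x)
  ... | tri≈ _ refl _ = i , x · y
  ... | tri> _ _ _    = if does (y ≟ 1#) then (i , x) else (j , y)

  _⇒⊕_ : Op₂ Union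
  (i , x) ⇒⊕ (j , y) with compare i j
  ... | tri< _ _ _    = if does (x ≟ 1#) then (j , y) else 1⊕
  ... | tri≈ _ refl _ = i , x ⇒ y
  ... | tri> _ _ _    = j , y

  _≈⊕1? : (u : Union) → Dec (proj₂ u ≈ᴬ 1#)
  (i , x) ≈⊕1? = x ≟ 1#

  -- minimum and maximum for the total order "x ≤ y iff x ⇒ y = 1"
  _∧⊕_ : Op₂ Union
  u ∧⊕ v = if does ((u ⇒⊕ v) ≈⊕1?) then u else v

  _∨⊕_ : Op₂ Union
  u ∨⊕ v = if does ((u ⇒⊕ v) ≈⊕1?) then v else u

  ordinalSum : RawSemihoop (ι ⊔ c) (ι ⊔ c ⊔ ℓ)
  ordinalSum = record
    { Carrier = Union
    ; _≈_ = _≈⊕_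
    ; _·_ = _·⊕_
    ; _⇒_ = _⇒⊕_
    ; _∧_ = _∧⊕_
    ; _∨_ = _∨⊕_
    ; 1#  = 1⊕
    }

open OrdinalSum public using (ordinalSum)

{-# OPTIONS --safe #-}
-- The idea: in a finite chain the powers of x stabilise at an idempotent ω x. If
-- ω x < ω z, then local unitality at the idempotent ω z gives ω z · x = x, hence
-- z · x = x. So elements with different ω multiply and residuate as in an ordinal
-- sum, while {x | ω x = e} ∪ {1} is, for each idempotent e, an archimedean chain
-- with least element e.
module Submission where

open import Defs
open import Level using (0ℓ; _⊔_)
open import Algebra.Bundles using (CommutativeMonoid)
open import Algebra.Lattice.Bundles using (Lattice)
open import Algebra.Lattice.Structures using (IsLattice)
open import Algebra.Structures using (IsCommutativeMonoid)
import Algebra.Lattice.Properties.Lattice as LatticeProperties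
import Algebra.Properties.CommutativeMonoid.Mult as Mult
open import Data.Bool.Base using (if_then_else_)
open import Data.Bool.Properties using (T?)
open import Data.Fin.Base using (Fin; toℕ)
open import Data.Fin.Properties using (pigeonhole; toℕ<n) renaming (_≟_ to _≟ᶠ_)
open import Data.Nat.Base as ℕ using (ℕ; zero; suc; s≤s)
import Data.Nat.Properties as ℕ
open import Data.Product using (Σ-syntax; _×_; ∃; _,_; proj₁; proj₂)
open import Data.Sum.Base using (_⊎_; inj₁; inj₂)
open import Function.Base using (_on_)
open import Function.Bundles using (Inverse; Equivalence)
open import Relation.Binary.Bundles using (Poset)
import Relation.Binary.Construct.NonStrictToStrict as ToStrict
import Relation.Binary.Construct.On as On
open import Relation.Binary.Core using (Rel)
open import Relation.Binary.Definitions using (Decidable; Total; tri<; tri≈; tri>)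
open import Relation.Binary.PropositionalEquality as ≡ using (_≡_; _≢_)
import Relation.Binary.Reasoning.PartialOrder as PosetReasoning
open import Relation.Binary.Structures using (IsDecTotalOrder; IsStrictTotalOrder)
open import Relation.Nullary.Decidable using (Dec; yes; no; does; map′; True; toWitness; fromWitness)
open import Relation.Nullary.Negation using (¬_; contradiction)
open import Relation.Unary using (Pred)

-- The operations of the ordinal sum branch on `does`; this replaces such a branch by two cases that
-- carry the evidence.
if-does : ∀ {a p r} {A : Set a} {P : Set p} (R : A → Set r) (P? : Dec P) {x y : A} →
          (P → R x) → (¬ P → R y) → R (if does P? then x else y)
if-does R (yes p) f g = f p
if-does R (no ¬p) f g = g ¬p

-- Order, residuation and powers in a semihoop.

module SemihoopProperties {c ℓ} (S : Semihoop c ℓ) where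
  open Semihoop S

  lattice : Lattice c ℓ
  lattice = record { isLattice = isLattice }

  ·-commutativeMonoid : CommutativeMonoid c ℓ
  ·-commutativeMonoid = record { isCommutativeMonoid = ·-isCommutativeMonoid }

  open LatticeProperties lattice public using (poset)
  open Lattice lattice public
    using (refl; sym; trans; ∧-comm; ∨-comm; ∨-cong; ∨-absorbs-∧)
  open Poset poset public using ()
    renaming (reflexive to ≤-reflexive; refl to ≤-refl; trans to ≤-trans; antisym to ≤-antisym;
              ≤-respˡ-≈ to ≤-respˡ-≈; ≤-respʳ-≈ to ≤-respʳ-≈)
  open CommutativeMonoid ·-commutativeMonoid public using ()
    renaming (∙-cong to ·-cong; ∙-congˡ to ·-congˡ; ∙-congʳ to ·-congʳ;
              comm to ·-comm; identityˡ to ·-identityˡ; identityʳ to ·-identityʳ)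
  open Mult ·-commutativeMonoid public using ()
    renaming (×-congʳ to ^-congˡ; ×-congˡ to ^-congʳ; ×-homo-+ to ^-homo-+;
              ×-distrib-+ to ^-distrib-·; ×-idem to ^-idem)

  residuate : ∀ {x y z} → x · y ≤ z → x ≤ y ⇒ z
  residuate {x} {y} {z} = Equivalence.to (residuation x y z)

  unresiduate : ∀ {x y z} → x ≤ y ⇒ z → x · y ≤ z
  unresiduate {x} {y} {z} = Equivalence.from (residuation x y z)

  ·-monoˡ : ∀ {x y z} → x ≤ y → x · z ≤ y · z
  ·-monoˡ x≤y = unresiduate (≤-trans x≤y (residuate ≤-refl))

  ·-monoʳ : ∀ {x y z} → y ≤ z → x · y ≤ x · z
  ·-monoʳ {x} {y} {z} y≤z = ≤-respˡ-≈ (·-comm y x) (≤-respʳ-≈ (·-comm z x) (·-monoˡ y≤z))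

  x·y≤y : ∀ x y → x · y ≤ y
  x·y≤y x y = ≤-respʳ-≈ (·-identityˡ y) (·-monoˡ (1-greatest x))

  x·y≤x : ∀ x y → x · y ≤ x
  x·y≤x x y = ≤-respˡ-≈ (·-comm y x) (x·y≤y y x)

  1≤x⇒x≈1 : ∀ {x} → 1# ≤ x → x ≈ 1#
  1≤x⇒x≈1 = ≤-antisym (1-greatest _)

  x≤y⇒[x⇒y]≈1 : ∀ {x y} → x ≤ y → x ⇒ y ≈ 1#
  x≤y⇒[x⇒y]≈1 x≤y = 1≤x⇒x≈1 (residuate (≤-respˡ-≈ (sym (·-identityˡ _)) x≤y))

  [x⇒y]≈1⇒x≤y : ∀ {x y} → x ⇒ y ≈ 1# → x ≤ y
  [x⇒y]≈1⇒x≤y eq = ≤-respˡ-≈ (·-identityˡ _) (unresiduate (≤-reflexive (sym eq)))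

  y≤x⇒y : ∀ x y → y ≤ x ⇒ y
  y≤x⇒y x y = residuate (x·y≤x y x)

  x≈1⇒[x⇒y]≈y : ∀ {x y} → x ≈ 1# → x ⇒ y ≈ y
  x≈1⇒[x⇒y]≈y {x} {y} x≈1 = ≤-antisym
    (≤-respˡ-≈ (trans (·-congˡ x≈1) (·-identityʳ _)) (unresiduate ≤-refl))
    (y≤x⇒y x y)

  x≤y⇒x∨y≈y : ∀ {x y} → x ≤ y → x ∨ y ≈ y
  x≤y⇒x∨y≈y {x} {y} x≤y =
    trans (∨-comm x y) (trans (∨-cong refl (trans x≤y (∧-comm x y))) (∨-absorbs-∧ y x))

  ^-monoˡ : ∀ n {x y} → x ≤ y → x ^ n ≤ y ^ n
  ^-monoˡ zero    x≤y = ≤-refl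
  ^-monoˡ (suc n) x≤y = ≤-trans (·-monoˡ x≤y) (·-monoʳ (^-monoˡ n x≤y))

  ^-antiʳ : ∀ x {m n} → m ℕ.≤ n → x ^ n ≤ x ^ m
  ^-antiʳ x {n = n} ℕ.z≤n = 1-greatest (x ^ n)
  ^-antiʳ x (s≤s m≤n)     = ·-monoʳ (^-antiʳ x m≤n)

  -- Each further factor `x` is absorbed by `eq`; the induction runs on the difference `n ∸ m`.
  ^-stable : ∀ {x m n} → x ^ suc m ≈ x ^ m → m ℕ.≤ n → x ^ n ≈ x ^ m
  ^-stable {x} {m} {n} eq m≤n = trans (^-congʳ (≡.sym (ℕ.m∸n+n≡m m≤n))) (go (n ℕ.∸ m))
    where
    go : ∀ k → x ^ (k ℕ.+ m) ≈ x ^ m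
    go zero    = refl
    go (suc k) = trans (·-congˡ (go k)) eq

-- Subsemihoops.

module _ {c ℓ} (S : Semihoop c ℓ) where
  open Semihoop S

  record IsSubsemihoop {p} (P : Pred Carrier p) : Set (c ⊔ p) where
    field
      ·-closed : ∀ {x y} → P x → P y → P (x · y)
      ⇒-closed : ∀ {x y} → P x → P y → P (x ⇒ y)
      ∧-closed : ∀ {x y} → P x → P y → P (x ∧ y)
      ∨-closed : ∀ {x y} → P x → P y → P (x ∨ y)
      1-closed : P 1#

  -- Equality compares first components only, so membership proofs carry no information and every
  -- law is inherited.
  subsemihoop : ∀ {p} {P : Pred Carrier p} → IsSubsemihoop P → Semihoop (c ⊔ p) ℓ
  subsemihoop {P = P} sub = record
    { rawSemihoop = record
      { Carrier = ∃ P
      ; _≈_ = _≈_ on proj₁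
      ; _·_ = λ (x , p) (y , q) → x · y , ·-closed p q
      ; _⇒_ = λ (x , p) (y , q) → x ⇒ y , ⇒-closed p q
      ; _∧_ = λ (x , p) (y , q) → x ∧ y , ∧-closed p q
      ; _∨_ = λ (x , p) (y , q) → x ∨ y , ∨-closed p q
      ; 1#  = 1# , 1-closed
      }
    ; isSemihoop = record
      { isLattice = record
        { isEquivalence = On.isEquivalence proj₁ L.isEquivalence
        ; ∨-comm        = λ (x , _) (y , _) → L.∨-comm x y
        ; ∨-assoc       = λ (x , _) (y , _) (z , _) → L.∨-assoc x y z
        ; ∨-cong        = L.∨-cong
        ; ∧-comm        = λ (x , _) (y , _) → L.∧-comm x y
        ; ∧-assoc       = λ (x , _) (y , _) (z , _) → L.∧-assoc x y z
        ; ∧-cong        = L.∧-cong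
        ; absorptive    = (λ (x , _) (y , _) → L.∨-absorbs-∧ x y)
                        , (λ (x , _) (y , _) → L.∧-absorbs-∨ x y)
        }
      ; 1-greatest = λ (x , _) → 1-greatest x
      ; ·-isCommutativeMonoid = record
        { isMonoid = record
          { isSemigroup = record
            { isMagma = record
              { isEquivalence = On.isEquivalence proj₁ L.isEquivalence
              ; ∙-cong        = M.∙-cong
              }
            ; assoc = λ (x , _) (y , _) (z , _) → M.assoc x y z
            }
          ; identity = (λ (x , _) → M.identityˡ x) , (λ (x , _) → M.identityʳ x)
          }
        ; comm = λ (x , _) (y , _) → M.comm x y
        }
      ; ⇒-cong       = ⇒-cong
      ; residuation  = λ (x , _) (y , _) (z , _) → residuation x y z
      ; prelinearity = λ (x , _) (y , _) → prelinearity x y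
      }
    }
    where
    open IsSubsemihoop sub
    module L = IsLattice isLattice
    module M = IsCommutativeMonoid ·-isCommutativeMonoid

  -- Powers of pairs recurse on the exponent, so for a variable `n` the projection commutes with
  -- them only by induction. Needed to recognise `ω` inside a component.
  ^-proj₁ : ∀ {p} {P : Pred Carrier p} (sub : IsSubsemihoop P) (x : ∃ P) n →
            proj₁ (Semihoop._^_ (subsemihoop sub) x n) ≡ proj₁ x ^ n
  ^-proj₁ sub x zero    = ≡.refl
  ^-proj₁ sub x (suc n) = ≡.cong (proj₁ x ·_) (^-proj₁ sub x n)

-- Finite chains: the order on indices and the idempotent power.

module FiniteChain {c ℓ} (A : MTLChain c ℓ) (finite : Finite (MTLChain.≈-setoid A)) where
  open MTLChain A
  open SemihoopProperties semihoop

  size : ℕ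
  size = proj₁ finite

  open Inverse (proj₂ finite) using (to; from; to-cong; from-cong; inverseˡ; inverseʳ)

  element : Fin size → Carrier
  element = to

  index : Carrier → Fin size
  index = from

  index-cong : ∀ {x y} → x ≈ y → index x ≡ index y
  index-cong = from-cong

  element-index : ∀ x → element (index x) ≈ x
  element-index x = inverseˡ ≡.refl

  element-injective : ∀ {i j} → element i ≈ element j → i ≡ j
  element-injective eq = ≡.trans (≡.sym (inverseʳ refl)) (inverseʳ eq)

  infix 4 _≟_ _≤?_ _≤ᴵ_

  _≟_ : Decidable _≈_
  x ≟ y = map′ (λ eq → trans (sym (element-index x)) (trans (to-cong eq) (element-index y)))
               index-cong (index x ≟ᶠ index y)

  _≤?_ : Decidable _≤_
  x ≤? y = x ≟ (x ∧ y)

  -- `True` puts the order at level `0ℓ`, whatever the level of `_≤_`.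
  _≤ᴵ_ : Rel (Fin size) 0ℓ
  i ≤ᴵ j = True (element i ≤? element j)

  ≤ᴵ⇒≤ : ∀ i j → i ≤ᴵ j → element i ≤ element j
  ≤ᴵ⇒≤ i j = toWitness {a? = element i ≤? element j}

  ≤⇒≤ᴵ : ∀ i j → element i ≤ element j → i ≤ᴵ j
  ≤⇒≤ᴵ i j = fromWitness {a? = element i ≤? element j}

  ≤ᴵ-total : Total _≤ᴵ_
  ≤ᴵ-total i j with ≤-total (element i) (element j)
  ... | inj₁ i≤j = inj₁ (≤⇒≤ᴵ i j i≤j)
  ... | inj₂ j≤i = inj₂ (≤⇒≤ᴵ j i j≤i)

  ≤ᴵ-isDecTotalOrder : IsDecTotalOrder _≡_ _≤ᴵ_
  ≤ᴵ-isDecTotalOrder = record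
    { isTotalOrder = record
      { isPartialOrder = record
        { isPreorder = record
          { isEquivalence = ≡.isEquivalence
          ; reflexive     = λ {i} {j} i≡j → ≤⇒≤ᴵ i j (≤-reflexive (to-cong i≡j))
          ; trans         = λ {i} {j} {k} i≤j j≤k →
              ≤⇒≤ᴵ i k (≤-trans (≤ᴵ⇒≤ i j i≤j) (≤ᴵ⇒≤ j k j≤k))
          }
        ; antisym = λ {i} {j} i≤j j≤i →
            element-injective (≤-antisym (≤ᴵ⇒≤ i j i≤j) (≤ᴵ⇒≤ j i j≤i))
        }
      ; total = ≤ᴵ-total
      }
    ; _≟_  = _≟ᶠ_
    ; _≤?_ = λ i j → T? _
    }

  -- The exponent size would do as well; suc size makes ω x ≤ x immediate.
  ω : Carrier → Carrier
  ω x = x ^ suc size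

  ω-cong : ∀ {x y} → x ≈ y → ω x ≈ ω y
  ω-cong = ^-congˡ (suc size)

  ω-mono : ∀ {x y} → x ≤ y → ω x ≤ ω y
  ω-mono = ^-monoˡ (suc size)

  ωx≤x : ∀ x → ω x ≤ x
  ωx≤x x = x·y≤x x (x ^ size)

  ω-· : ∀ x y → ω (x · y) ≈ ω x · ω y
  ω-· x y = ^-distrib-· x y (suc size)

  -- Among the powers with exponents from 0 to `size` two coincide, by pigeonhole. As powers
  -- decrease, they are constant from the smaller exponent on, and both `N` and `N + N` are past it.
  ω-idem : ∀ x → ω x · ω x ≈ ω x
  ω-idem x
    with i , j , i<j , eq ← pigeonhole (ℕ.n<1+n size) (λ (k : Fin (suc size)) → index (x ^ toℕ k))
    = trans (sym (^-homo-+ x N N)) (trans (stable (ℕ.≤-trans i≤N (ℕ.m≤m+n N N))) (sym (stable i≤N)))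
    where
    N = suc size
    i≤N : toℕ i ℕ.≤ N
    i≤N = ℕ.<⇒≤ (toℕ<n i)
    xⁱ≈xʲ : x ^ toℕ i ≈ x ^ toℕ j
    xⁱ≈xʲ = trans (sym (element-index _)) (trans (to-cong eq) (element-index _))
    stable : ∀ {n} → toℕ i ℕ.≤ n → x ^ n ≈ x ^ toℕ i
    -- `x ^ suc (toℕ i)` lies between `x ^ toℕ j` and `x ^ toℕ i`, which are equal.
    stable = ^-stable (≤-antisym (x·y≤y x _) (≤-respˡ-≈ (sym xⁱ≈xʲ) (^-antiʳ x i<j)))

  ω-ω : ∀ x → ω (ω x) ≈ ω x
  ω-ω x = ^-idem (ω-idem x) (suc size)

-- Decomposition: first, products and residuals of elements with different `ω`.

module Decomposition {c ℓ} (A : MTLChain c ℓ) (finite : Finite (MTLChain.≈-setoid A))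
  (locallyUnital : LocallyUnital (MTLChain.mtlAlgebra A)) where
  open MTLChain A
  open SemihoopProperties semihoop
  open FiniteChain A finite

  -- The one place where local unitality is applied, at the idempotent `ω z`.
  ω-absorbs : ∀ {x z} → x ≤ ω z → ω z · x ≈ x
  ω-absorbs {x} {z} x≤ωz =
    locallyUnital (ω z) x (ω-idem z) (trans (∨-comm _ _) (x≤y⇒x∨y≈y x≤ωz))

  -- Otherwise `ω z ≤ x`, and applying `ω`, which is monotone and fixes `ω z`, gives `ω z ≤ ω x`.
  ω≰⇒≤ω : ∀ {x z} → ¬ ω z ≤ ω x → x ≤ ω z
  ω≰⇒≤ω {x} {z} ωz≰ωx with ≤-total x (ω z)
  ... | inj₁ x≤ωz = x≤ωz
  ... | inj₂ ωz≤x = contradiction (≤-respˡ-≈ (ω-ω z) (ω-mono ωz≤x)) ωz≰ωx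

  ω≰⇒≤ : ∀ {x z} → ¬ ω z ≤ ω x → x ≤ z
  ω≰⇒≤ {z = z} ωz≰ωx = ≤-trans (ω≰⇒≤ω ωz≰ωx) (ωx≤x z)

  -- A squeeze: `x ≈ ω z · x ≤ z · x ≤ x`.
  ω≰⇒z·x≈x : ∀ {x z} → ¬ ω z ≤ ω x → z · x ≈ x
  ω≰⇒z·x≈x {x} {z} ωz≰ωx = ≤-antisym (x·y≤y z x)
    (≤-respˡ-≈ (ω-absorbs (ω≰⇒≤ω ωz≰ωx)) (·-monoˡ (ωx≤x z)))

  -- Put `w = z ⇒ x`, so that `ω w · ω z ≤ ω x`. If `ω z ≤ ω w`, the left side is `ω z`, against the
  -- hypothesis. Hence `z` fixes `w`, and `w · z ≤ x` becomes `w ≤ x`.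
  ω≰⇒[z⇒x]≈x : ∀ {x z} → ¬ ω z ≤ ω x → z ⇒ x ≈ x
  ω≰⇒[z⇒x]≈x {x} {z} ωz≰ωx = ≤-antisym w≤x (y≤x⇒y z x)
    where
    w = z ⇒ x
    w·z≤x : w · z ≤ x
    w·z≤x = unresiduate ≤-refl
    ωwωz≤ωx : ω w · ω z ≤ ω x
    ωwωz≤ωx = ≤-respˡ-≈ (ω-· w z) (ω-mono w·z≤x)
    w≤x : w ≤ x
    w≤x with ω z ≤? ω w
    ... | yes ωz≤ωw = contradiction (≤-respˡ-≈ (ω-absorbs ωz≤ωw) ωwωz≤ωx) ωz≰ωx
    ... | no  ωz≰ωw = ≤-respˡ-≈ (trans (·-comm w z) (ω≰⇒z·x≈x ωz≰ωw)) w·z≤x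

  -- The components as archimedean MTL-chains.

  -- When element i is not idempotent, no ω x equals it and the component is {1},
  -- which contributes nothing to the ordinal sum.
  Component : Fin size → Pred Carrier ℓ
  Component i x = ω x ≈ element i ⊎ x ≈ 1#

  ·-closed : ∀ {i x y} → Component i x → Component i y → Component i (x · y)
  ·-closed {x = x} {y} (inj₁ p) (inj₁ q) =
    inj₁ (trans (ω-· x y) (trans (·-congˡ (trans q (sym p))) (trans (ω-idem x) p)))
  ·-closed (inj₁ p) (inj₂ q) = inj₁ (trans (ω-cong (trans (·-congˡ q) (·-identityʳ _))) p)
  ·-closed (inj₂ p) (inj₁ q) = inj₁ (trans (ω-cong (trans (·-congʳ p) (·-identityˡ _))) q)
  ·-closed (inj₂ p) (inj₂ q) = inj₂ (trans (·-cong p q) (·-identityˡ _))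

  Component-resp-≈ : ∀ {i x y} → x ≈ y → Component i x → Component i y
  Component-resp-≈ x≈y (inj₁ p) = inj₁ (trans (ω-cong (sym x≈y)) p)
  Component-resp-≈ x≈y (inj₂ p) = inj₂ (trans (sym x≈y) p)

  -- If ω (x ⇒ y) exceeded the common value of ω, then x ⇒ y would fix x, so that
  -- x ≤ y and x ⇒ y = 1.
  ⇒-closed : ∀ {i x y} → Component i x → Component i y → Component i (x ⇒ y)
  ⇒-closed (inj₂ p) cy = Component-resp-≈ (sym (x≈1⇒[x⇒y]≈y p)) cy
  ⇒-closed {x = x} (inj₁ p) (inj₂ q) =
    inj₂ (x≤y⇒[x⇒y]≈1 (≤-respʳ-≈ (sym q) (1-greatest x)))
  ⇒-closed {x = x} {y} (inj₁ p) (inj₁ q) with ω (x ⇒ y) ≤? ω x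
  ... | yes ω≤ = inj₁ (≤-antisym (≤-respʳ-≈ p ω≤) (≤-respˡ-≈ q (ω-mono (y≤x⇒y x y))))
  ... | no  ω≰ = inj₂ (x≤y⇒[x⇒y]≈1 (≤-respˡ-≈ (ω≰⇒z·x≈x ω≰) (unresiduate ≤-refl)))

  ∧-closed : ∀ {i x y} → Component i x → Component i y → Component i (x ∧ y)
  ∧-closed {x = x} {y} cx cy with ≤-total x y
  -- `x ≤ y` unfolds to `x ≈ x ∧ y`, so the inequality serves as the equation.
  ... | inj₁ x≤y = Component-resp-≈ x≤y cx
  ... | inj₂ y≤x = Component-resp-≈ (trans y≤x (∧-comm y x)) cy

  ∨-closed : ∀ {i x y} → Component i x → Component i y → Component i (x ∨ y)
  ∨-closed {x = x} {y} cx cy with ≤-total x y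
  ... | inj₁ x≤y = Component-resp-≈ (sym (x≤y⇒x∨y≈y x≤y)) cy
  ... | inj₂ y≤x = Component-resp-≈ (trans (sym (x≤y⇒x∨y≈y y≤x)) (∨-comm y x)) cx

  isSubsemihoop : ∀ i → IsSubsemihoop semihoop (Component i)
  isSubsemihoop i = record
    { ·-closed = ·-closed
    ; ⇒-closed = ⇒-closed
    ; ∧-closed = ∧-closed
    ; ∨-closed = ∨-closed
    ; 1-closed = inj₂ refl
    }

  -- If `ω` fixes `element i`, that element is in the component and lies below the rest because
  -- `ω x ≤ x`. If not, `ω x ≈ element i` is impossible, since `ω` fixes its values, and only 1
  -- remains.
  least : ∀ i → Σ[ z ∈ ∃ (Component i) ] (∀ x → Component i x → proj₁ z ≤ x)
  least i with ω (element i) ≟ element i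
  ... | yes idem = (element i , inj₁ idem) , λ where
    x (inj₁ ωx≈i) → ≤-respˡ-≈ ωx≈i (ωx≤x x)
    x (inj₂ x≈1)  → ≤-respʳ-≈ (sym x≈1) (1-greatest _)
  ... | no ¬idem = (1# , inj₂ refl) , λ where
    x (inj₁ ωx≈i) → contradiction (trans (ω-cong (sym ωx≈i)) (trans (ω-ω x) ωx≈i)) ¬idem
    x (inj₂ x≈1)  → ≤-reflexive (sym x≈1)

  component : Fin size → MTLChain (c ⊔ ℓ) ℓ
  component i = record
    { mtlAlgebra = record
      { semihoop = subsemihoop semihoop (isSubsemihoop i)
      ; 0#       = proj₁ (least i)
      ; 0-least  = λ (x , cx) → proj₂ (least i) x cx
      }
    ; ≤-total = λ (x , _) (y , _) → ≤-total x y
    }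

  component-≟ : ∀ {i} → Decidable (MTLChain._≈_ (component i))
  component-≟ (x , _) (y , _) = x ≟ y

  component-archimedean : ∀ i → Archimedean (component i)
  component-archimedean i (x , cx) (y , inj₂ y≈1) x≤y (_ , y≉1) = contradiction y≈1 y≉1
  component-archimedean i (x , inj₂ x≈1) (y , _) x≤y (_ , y≉1) =
    contradiction (1≤x⇒x≈1 (≤-respˡ-≈ x≈1 x≤y)) y≉1
  -- The exponent is that of `ω`: `ω y ≈ element i ≈ ω x ≤ x`.
  component-archimedean i (x , inj₁ ωx≈i) y@(_ , inj₁ ωy≈i) x≤y _ = suc size ,
    ≡.subst (_≤ x) (≡.sym (^-proj₁ semihoop (isSubsemihoop i) y (suc size)))
      (≤-respˡ-≈ (trans ωx≈i (sym ωy≈i)) (ωx≤x x))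

  -- Turns a strict comparison of indices into the hypothesis of the `ω≰` lemmas; otherwise
  -- antisymmetry and injectivity of `element` would give `i ≡ j`.
  ω≰-across : ∀ {i j x y} → i ≤ᴵ j → i ≢ j → ω x ≈ element i → ω y ≈ element j → ¬ ω y ≤ ω x
  ω≰-across {i} {j} i≤j i≢j ωx≈i ωy≈j ωy≤ωx =
    i≢j (element-injective (≤-antisym (≤ᴵ⇒≤ i j i≤j) (≤-respˡ-≈ ωy≈j (≤-respʳ-≈ ωx≈i ωy≤ωx))))

  -- The isomorphism with the ordinal sum.

  module Sum = OrdinalSum ≤ᴵ-isDecTotalOrder (index 1#)
    (λ i → MTLChain.semihoopChain (component i)) (λ {i} → component-≟ {i})
  open Sum using (Union; _≈⊕_; unit; same; _·⊕_; _⇒⊕_; _∧⊕_; _∨⊕_; _≈⊕1?)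
  open IsStrictTotalOrder (ToStrict.<-isStrictTotalOrder₂ _≡_ _≤ᴵ_ ≤ᴵ-isDecTotalOrder)
    using (compare)

  forget : Union → Carrier
  forget (_ , x , _) = x

  forget-cong : ∀ {u v} → u ≈⊕ v → forget u ≈ forget v
  forget-cong (unit x≈1 y≈1) = trans x≈1 (sym y≈1)
  forget-cong (same x≈y)     = x≈y

  -- If one side is known to be 1, so is the other, and `unit` applies. Otherwise equal elements
  -- have equal `ω`, which determines the index.
  forget-injective : ∀ u v → forget u ≈ forget v → u ≈⊕ v
  forget-injective (i , x , inj₂ x≈1) (j , y , _) x≈y = unit x≈1 (trans (sym x≈y) x≈1)
  forget-injective (i , x , inj₁ _) (j , y , inj₂ y≈1) x≈y = unit (trans x≈y y≈1) y≈1
  forget-injective (i , x , inj₁ p) (j , y , inj₁ q) x≈y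
    with ≡.refl ← element-injective (trans (sym p) (trans (ω-cong x≈y) q)) = same x≈y

  -- Across different summands, apart from the cases of a unit, the factor of higher index fixes the
  -- one of lower index by `ω≰⇒z·x≈x`.
  forget-· : ∀ u v → forget (u ·⊕ v) ≈ forget u · forget v
  forget-· (i , x , cx) (j , y , cy) with compare i j
  ... | tri≈ _ ≡.refl _ = refl
  ... | tri< (i≤j , i≢j) _ _ = if-does (λ u → forget u ≈ x · y) (x ≟ 1#)
    (λ x≈1 → sym (trans (·-congʳ x≈1) (·-identityˡ y)))
    (λ x≉1 → sym (x·y≈x x≉1 cx cy))
    where
    x·y≈x : ¬ x ≈ 1# → Component i x → Component j y → x · y ≈ x
    x·y≈x x≉1 (inj₂ x≈1) _          = contradiction x≈1 x≉1
    x·y≈x x≉1 (inj₁ p)   (inj₂ y≈1) = trans (·-congˡ y≈1) (·-identityʳ x)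
    x·y≈x x≉1 (inj₁ p)   (inj₁ q)   = trans (·-comm x y) (ω≰⇒z·x≈x (ω≰-across i≤j i≢j p q))
  ... | tri> _ _ (j≤i , j≢i) = if-does (λ u → forget u ≈ x · y) (y ≟ 1#)
    (λ y≈1 → sym (trans (·-congˡ y≈1) (·-identityʳ x)))
    (λ y≉1 → sym (x·y≈y y≉1 cx cy))
    where
    x·y≈y : ¬ y ≈ 1# → Component i x → Component j y → x · y ≈ y
    x·y≈y y≉1 _          (inj₂ y≈1) = contradiction y≈1 y≉1
    x·y≈y y≉1 (inj₂ x≈1) (inj₁ q)   = trans (·-congʳ x≈1) (·-identityˡ y)
    x·y≈y y≉1 (inj₁ p)   (inj₁ q)   = ω≰⇒z·x≈x (ω≰-across j≤i j≢i q p)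

  forget-⇒ : ∀ u v → forget (u ⇒⊕ v) ≈ forget u ⇒ forget v
  forget-⇒ (i , x , cx) (j , y , cy) with compare i j
  ... | tri≈ _ ≡.refl _ = refl
  ... | tri< (i≤j , i≢j) _ _ = if-does (λ u → forget u ≈ x ⇒ y) (x ≟ 1#)
    (λ x≈1 → sym (x≈1⇒[x⇒y]≈y x≈1))
    (λ x≉1 → sym (x≤y⇒[x⇒y]≈1 (x≤y x≉1 cx cy)))
    where
    x≤y : ¬ x ≈ 1# → Component i x → Component j y → x ≤ y
    x≤y x≉1 (inj₂ x≈1) _          = contradiction x≈1 x≉1
    x≤y x≉1 (inj₁ p)   (inj₂ y≈1) = ≤-respʳ-≈ (sym y≈1) (1-greatest x)
    x≤y x≉1 (inj₁ p)   (inj₁ q)   = ω≰⇒≤ (ω≰-across i≤j i≢j p q)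
  ... | tri> _ _ (j≤i , j≢i) = sym ([x⇒y]≈y cx cy)
    where
    [x⇒y]≈y : Component i x → Component j y → x ⇒ y ≈ y
    [x⇒y]≈y (inj₂ x≈1) _          = x≈1⇒[x⇒y]≈y x≈1
    [x⇒y]≈y (inj₁ p)   (inj₂ y≈1) =
      trans (x≤y⇒[x⇒y]≈1 (≤-respʳ-≈ (sym y≈1) (1-greatest x))) (sym y≈1)
    [x⇒y]≈y (inj₁ p)   (inj₁ q)   = ω≰⇒[z⇒x]≈x (ω≰-across j≤i j≢i q p)

  -- `_∧⊕_` and `_∨⊕_` test whether `u ⇒⊕ v` is 1; this lemma and the next read the two outcomes as
  -- comparisons in the original chain.
  ⇒⊕≈1⇒≤ : ∀ u v → forget (u ⇒⊕ v) ≈ 1# → forget u ≤ forget v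
  ⇒⊕≈1⇒≤ u v eq = [x⇒y]≈1⇒x≤y (trans (sym (forget-⇒ u v)) eq)

  ⇒⊕≉1⇒≥ : ∀ u v → ¬ forget (u ⇒⊕ v) ≈ 1# → forget v ≤ forget u
  ⇒⊕≉1⇒≥ u v neq with ≤-total (forget u) (forget v)
  ... | inj₁ u≤v = contradiction (trans (forget-⇒ u v) (x≤y⇒[x⇒y]≈1 u≤v)) neq
  ... | inj₂ v≤u = v≤u

  forget-∧ : ∀ u v → forget (u ∧⊕ v) ≈ forget u ∧ forget v
  forget-∧ u v = if-does (λ w → forget w ≈ forget u ∧ forget v) ((u ⇒⊕ v) ≈⊕1?)
    (⇒⊕≈1⇒≤ u v)
    (λ neq → trans (⇒⊕≉1⇒≥ u v neq) (∧-comm _ _))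

  forget-∨ : ∀ u v → forget (u ∨⊕ v) ≈ forget u ∨ forget v
  forget-∨ u v = if-does (λ w → forget w ≈ forget u ∨ forget v) ((u ⇒⊕ v) ≈⊕1?)
    (λ eq → sym (x≤y⇒x∨y≈y (⇒⊕≈1⇒≤ u v eq)))
    (λ neq → trans (sym (x≤y⇒x∨y≈y (⇒⊕≉1⇒≥ u v neq))) (∨-comm _ _))

  -- No case split on `x ≈ 1#` is made: 1 is placed at the index of `ω 1#`, and `_≈⊕_` identifies it
  -- with the units of all summands.
  embed : Carrier → Union
  embed x = index (ω x) , x , inj₁ (sym (element-index (ω x)))

  -- `forget (embed x)` reduces to `x`, so each law for `embed` is the law for `forget` pulled back
  -- along `forget-injective`, and `forget` supplies the preimages.
  embed-isIsomorphism : IsSemihoopIsomorphism rawSemihoop Sum.ordinalSum embed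
  embed-isIsomorphism = record
    { cong      = λ {x} {y} → forget-injective (embed x) (embed y)
    ; ·-homo    = λ x y → forget-injective _ _ (sym (forget-· (embed x) (embed y)))
    ; ⇒-homo    = λ x y → forget-injective _ _ (sym (forget-⇒ (embed x) (embed y)))
    ; ∧-homo    = λ x y → forget-injective _ _ (sym (forget-∧ (embed x) (embed y)))
    ; ∨-homo    = λ x y → forget-injective _ _ (sym (forget-∨ (embed x) (embed y)))
    ; 1-homo    = forget-injective _ _ refl
    ; bijective = forget-cong
                , λ u → forget u , λ {x} x≈u → forget-injective (embed x) u x≈u
    }

lemma2 : ∀ {c ℓ} (A : MTLChain c ℓ) →
    Finite (MTLChain.≈-setoid A) →
    LocallyUnital (MTLChain.mtlAlgebra A) →
    Σ[ I ∈ Set ] Σ[ le ∈ Rel I 0ℓ ] Σ[ isDecTotalOrder ∈ IsDecTotalOrder _≡_ le ] Σ[ i₀ ∈ I ]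
    Σ[ B ∈ (I → MTLChain (c ⊔ ℓ) ℓ) ]
    Σ[ eq? ∈ (∀ {i} → Decidable (MTLChain._≈_ (B i))) ]
    ((∀ i → Archimedean (B i)) ×
    (MTLChain.rawSemihoop A ≅
    ordinalSum isDecTotalOrder i₀ (λ i → MTLChain.semihoopChain (B i)) (λ {i} → eq? {i})))
lemma2 A finite locallyUnital =
  Fin size , _≤ᴵ_ , ≤ᴵ-isDecTotalOrder , index (MTLChain.1# A) ,
  component , (λ {i} → component-≟ {i}) ,
  component-archimedean , embed , embed-isIsomorphism
  where
  open FiniteChain A finite
  open Decomposition A finite locallyUnital
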